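{- Let $\mathcal G$ be a class of graphs that is polynomially $\chi$-bounded. Then $\mathcal G^\&$ is polynomially $\chi$-bounded.
   Context: All graphs are finite, simple and undirected; $\omega(G)$ is the clique number and $\chi(G)$ the chromatic number of $G$. A class $\mathcal G$ of graphs is $\chi$-bounded if there is a function $f$ such that for every $G\in\mathcal G$ and every induced subgraph $H$ of $G$, $\chi(H)\le f(\omega(H))$; it is polynomially $\chi$-bounded if $f$ can be taken to be a polynomial. For graphs $G_1,G_2$ with $|V(G_1)|,|V(G_2)|\ge 3$ and $V(G_1)\cap V(G_2)=\emptyset$, and vertices $v_1\in V(G_1)$, $v_2\in V(G_2)$, the $1$-join of $(G_1,v_1)$ and $(G_2,v_2)$ is the graph obtained from the disjoint union of $G_1$ and $G_2$ by deleting $v_1$ and $v_2$ and adding all edges between every neighbor of $v_1$ in $G_1$ and every neighbor of $v_2$ in $G_2$. For a class $\mathcal G$, $\mathcal G^\&$ denotes its closure under disjoint union and $1$-join. -}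

module Defs where

open import Data.Nat using (ℕ; zero; suc; _+_; _*_; _≤_; pred)
open import Data.Bool using (Bool; true; false; _∧_)
open import Data.Fin using (Fin; splitAt; punchIn)
open import Data.Sum using (_⊎_; inj₁; inj₂)
open import Data.Product using (Σ; _×_; _,_)
open import Data.List using (List; []; _∷_)
open import Relation.Binary.PropositionalEquality using (_≡_; _≢_; refl; sym)
open import Function.Definitions using (Injective)
open import Function.Bundles using (_↔_; Inverse)

record Graph : Set where
  field
    n     : ℕ
    adj   : Fin n → Fin n → Bool
    adj-sym   : ∀ i j → adj i j ≡ adj j i
    adj-irr   : ∀ i → adj i i ≡ false
open Graph public

GraphClass : Set₁
GraphClass = Graph → Set

induced : (G : Graph) {m : ℕ} → (Fin m → Fin (n G)) → Graph
induced G {m} ι = record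
  { n = m
  ; adj = λ i j → adj G (ι i) (ι j)
  ; adj-sym = λ i j → adj-sym G (ι i) (ι j)
  ; adj-irr = λ i → adj-irr G (ι i) }

record _≅_ (G H : Graph) : Set where
  field
    bij      : Fin (n G) ↔ Fin (n H)
    preserve : ∀ i j → adj G i j ≡ adj H (Inverse.to bij i) (Inverse.to bij j)

private
  adjS : ∀ {a b} → (Fin a → Fin a → Bool) → (Fin b → Fin b → Bool)
       → (Fin a → Fin b → Bool) → Fin a ⊎ Fin b → Fin a ⊎ Fin b → Bool
  adjS A B C (inj₁ i) (inj₁ j) = A i j
  adjS A B C (inj₂ i) (inj₂ j) = B i j
  adjS A B C (inj₁ i) (inj₂ j) = C i j
  adjS A B C (inj₂ j) (inj₁ i) = C i j

  adjS-sym : ∀ {a b} (A : Fin a → Fin a → Bool) (B : Fin b → Fin b → Bool) C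
           → (∀ i j → A i j ≡ A j i) → (∀ i j → B i j ≡ B j i)
           → ∀ p q → adjS A B C p q ≡ adjS A B C q p
  adjS-sym A B C sA sB (inj₁ i) (inj₁ j) = sA i j
  adjS-sym A B C sA sB (inj₂ i) (inj₂ j) = sB i j
  adjS-sym A B C sA sB (inj₁ i) (inj₂ j) = refl
  adjS-sym A B C sA sB (inj₂ j) (inj₁ i) = refl

  adjS-irr : ∀ {a b} (A : Fin a → Fin a → Bool) (B : Fin b → Fin b → Bool) C
           → (∀ i → A i i ≡ false) → (∀ i → B i i ≡ false)
           → ∀ p → adjS A B C p p ≡ false
  adjS-irr A B C iA iB (inj₁ i) = iA i
  adjS-irr A B C iA iB (inj₂ i) = iB i

sumGraph : (a b : ℕ) (A : Fin a → Fin a → Bool) (B : Fin b → Fin b → Bool)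
         → (∀ i j → A i j ≡ A j i) → (∀ i j → B i j ≡ B j i)
         → (∀ i → A i i ≡ false) → (∀ i → B i i ≡ false)
         → (Fin a → Fin b → Bool) → Graph
sumGraph a b A B sA sB iA iB C = record
  { n = a + b
  ; adj = λ x y → adjS A B C (splitAt a x) (splitAt a y)
  ; adj-sym = λ x y → adjS-sym A B C sA sB (splitAt a x) (splitAt a y)
  ; adj-irr = λ x → adjS-irr A B C iA iB (splitAt a x) }

disjointUnion : Graph → Graph → Graph
disjointUnion G H =
  sumGraph (n G) (n H) (adj G) (adj H) (adj-sym G) (adj-sym H)
           (adj-irr G) (adj-irr H) (λ _ _ → false)

skip : ∀ {k} → Fin k → Fin (pred k) → Fin k
skip {suc k} v i = punchIn v i

oneJoin : (G : Graph) (v : Fin (n G)) (H : Graph) (w : Fin (n H)) → Graph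
oneJoin G v H w =
  sumGraph (pred (n G)) (pred (n H))
    (adj (induced G (skip v))) (adj (induced H (skip w)))
    (adj-sym (induced G (skip v))) (adj-sym (induced H (skip w)))
    (adj-irr (induced G (skip v))) (adj-irr (induced H (skip w)))
    (λ i j → adj G v (skip v i) ∧ adj H w (skip w j))

-- 𝒢^& : closure of 𝒢 under disjoint union and 1-join (and isomorphism,
-- since graphs here have concrete vertex sets).
data Closure (𝒢 : GraphClass) : GraphClass where
  base  : ∀ {G} → 𝒢 G → Closure 𝒢 G
  iso   : ∀ {G H} → G ≅ H → Closure 𝒢 G → Closure 𝒢 H
  union : ∀ {G H} → Closure 𝒢 G → Closure 𝒢 H → Closure 𝒢 (disjointUnion G H)
  join  : ∀ {G H} → Closure 𝒢 G → Closure 𝒢 H → 3 ≤ n G → 3 ≤ n H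
        → (v : Fin (n G)) (w : Fin (n H)) → Closure 𝒢 (oneJoin G v H w)

HasClique : Graph → ℕ → Set
HasClique G k = Σ (Fin k → Fin (n G)) λ f →
  Injective _≡_ _≡_ f × (∀ i j → i ≢ j → adj G (f i) (f j) ≡ true)

IsCliqueNumber : Graph → ℕ → Set
IsCliqueNumber G w = HasClique G w × (∀ k → HasClique G k → k ≤ w)

Colorable : Graph → ℕ → Set
Colorable G k = Σ (Fin (n G) → Fin k) λ c →
  ∀ i j → adj G i j ≡ true → c i ≢ c j

Poly : Set
Poly = List ℕ

eval : Poly → ℕ → ℕ
eval []       x = 0
eval (a ∷ as) x = a + x * eval as x

PolyChiBounded : GraphClass → Set
PolyChiBounded 𝒢 = Σ Poly λ f →
  ∀ G → 𝒢 G → ∀ {m} (ι : Fin m → Fin (n G)) → Injective _≡_ _≡_ ι →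
  ∀ w → IsCliqueNumber (induced G ι) w → Colorable (induced G ι) (eval f w)

{-# OPTIONS --safe #-}

-- Call a graph good, for a function g, if for all vertex weights a and
-- every bound ω on the weights of its cliques, each vertex v can be given g (a v)
-- colours out of g ω so that adjacent vertices receive disjoint sets. Since the
-- clique weight of a module can serve as the weight of the vertex it replaces,
-- goodness is preserved by substitution, besides disjoint unions and induced
-- subgraphs.
--
-- Graphs of 𝒢 are good for g ω = 1 ^ 2k + 2 ^ 2k + ... + ω ^ 2k, where x ^ k bounds
-- the given polynomial for x ≥ 2. Vertices with 2 a ≤ ω are coloured by
-- thresholds: {v | a v ≥ j} contains no clique on more than ω / j vertices, so it
-- has a colouring by (ω / j) ^ k colours, and each of them is expanded into
-- g j ∸ g (j ∸ 1) = j ^ 2k colours. The vertices with 2 a > ω are independent, and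
-- the neighbours of such a vertex have weight at most ω ∸ a; it takes the g (a v)
-- colours following those of the thresholds up to ω ∸ a.
--
-- A 1-join is not a substitution, but it is one inside layers: each graph in the
-- closure has a layering, rooted at any prescribed vertex r, in which edges join
-- equal or consecutive layers, layer 0 is {r}, layer 1 is the neighbourhood of r,
-- and all layers are good. In the 1-join of (G , v) and (H , w), with H layered
-- from w, layer 1 of H is substituted for v and the later layers of H are added
-- disjointly to later layers of G. Two disjoint palettes, used by parity of the
-- layers, then colour the whole graph.

module Submission where

open import Defs
open import Data.Bool using (true; _∧_)
import Data.Bool as Bool
open import Data.Bool.Properties using (∧-comm)
open import Data.Fin using (Fin; toℕ; fromℕ<; splitAt; combine)
import Data.Fin as Fin
open import Data.Fin.Properties
  using (any?; toℕ<n; toℕ-injective; fromℕ<-injective; inject≤-injective; combine-injective;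
         splitAt-join; join-splitAt; punchIn-injective; punchInᵢ≢i)
open import Data.List using (List; []; _∷_; _++_; map; concatMap; filter; length; allFin; lookup; tabulate)
open import Data.List.Membership.Propositional using (_∈_)
open import Data.List.Membership.Propositional.Properties
  using (∈-∃++; ∈-filter⁺; ∈-filter⁻; ∈-map⁺; ∈-map⁻; ∈-allFin; ∈-lookup)
open import Data.List.Properties using (length-filter; length-tabulate; map-++; map-∘)
open import Data.List.Relation.Binary.Permutation.Propositional using (_↭_; ↭⇒↭ₛ)
import Data.List.Relation.Binary.Permutation.Propositional.Properties as Perm
import Data.List.Relation.Binary.Permutation.Setoid.Properties as PermSetoid
open import Data.List.Relation.Unary.All using (All; []; _∷_)
import Data.List.Relation.Unary.All as All
import Data.List.Relation.Unary.All.Properties as AllP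
open import Data.List.Relation.Unary.AllPairs using (AllPairs; []; _∷_)
import Data.List.Relation.Unary.AllPairs as AllPairs
import Data.List.Relation.Unary.AllPairs.Properties as AllPairsP
open import Data.List.Relation.Unary.Any using (here; there; index)
import Data.List.Relation.Unary.Any.Properties as AnyP
open import Data.List.Relation.Unary.Unique.Propositional.Properties using (allFin⁺)
open import Data.Nat
  using (ℕ; zero; suc; pred; _+_; _*_; _∸_; _^_; _/_; _≤_; _<_; z≤n; s≤s; _≟_; _≤?_; _<?_; >-nonZero)
open import Data.Nat.DivMod using (m/n*n≤m; m*n/n≡m; /-monoˡ-≤; m≥n⇒m/n>0)
open import Data.Nat.ListAction using (sum)
open import Data.Nat.ListAction.Properties using (sum-++; sum-↭)
open import Data.Nat.Properties hiding (_≟_; _≤?_; _<?_)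
open import Data.Product using (∃; _×_; _,_; proj₁; proj₂)
import Data.Product as Product
open import Data.Sum using (_⊎_; inj₁; inj₂; [_,_]′; swap)
import Data.Sum as Sum
import Data.Sum.Properties as SumP
open import Function using (_∘_; const)
open import Function.Bundles using (Inverse)
open import Function.Definitions using (Injective)
open import Level using (0ℓ)
open import Relation.Binary using (Rel; Decidable; Symmetric; DecidableEquality; tri<; tri≈; tri>)
open import Relation.Binary.PropositionalEquality hiding (J)
open import Relation.Nullary using (¬_; Dec; yes; no; contradiction; ¬?; _×-dec_)
open import Relation.Nullary.Decidable using (map′)
open import Relation.Unary using (Pred) renaming (Decidable to Decidable₁)

private variable
  V W : Set

-- Weighted cliques

weight : (V → ℕ) → List V → ℕ
weight a C = sum (map a C)

-- Cliques are represented as lists. For irreflexive `E`, `AllPairs E` already excludes repeated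
-- vertices.
CliquesBounded : Rel V 0ℓ → (V → ℕ) → ℕ → Set
CliquesBounded E a ω = ∀ C → AllPairs E C → weight a C ≤ ω

weight-++ : (a : V → ℕ) (C D : List V) → weight a (C ++ D) ≡ weight a C + weight a D
weight-++ a C D = trans (cong sum (map-++ a C D)) (sum-++ (map a C) (map a D))

weight-concatMap : (a : V → ℕ) (φ : W → List V) (C : List W) →
                   weight a (concatMap φ C) ≡ weight (weight a ∘ φ) C
weight-concatMap a φ [] = refl
weight-concatMap a φ (u ∷ C) =
  trans (weight-++ a (φ u) (concatMap φ C)) (cong (weight a (φ u) +_) (weight-concatMap a φ C))

weight-const1 : (C : List V) → weight (const 1) C ≡ length C
weight-const1 []      = refl
weight-const1 (u ∷ C) = cong suc (weight-const1 C)

-- Blowing up each vertex `u` of a clique of `E′` into the clique `φ u` yields a clique of `E` of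
-- the same total weight. An empty `φ u` means weight 0, so restrictions to a subset are covered as
-- well.
cliquesBounded-concatMap :
  {E : Rel V 0ℓ} {E′ : Rel W 0ℓ} {a : V → ℕ} {ω : ℕ} (φ : W → List V) →
  (∀ u → AllPairs E (φ u)) →
  (∀ {u v} → E′ u v → All (λ x → All (E x) (φ v)) (φ u)) →
  CliquesBounded E a ω → CliquesBounded E′ (weight a ∘ φ) ω
cliquesBounded-concatMap {a = a} {ω} φ inner cross bounded C clique =
  subst (_≤ ω) (weight-concatMap a φ C)
    (bounded (concatMap φ C)
      (AllPairsP.concat⁺ (AllP.map⁺ (All.universal inner C))
                         (AllPairsP.map⁺ (AllPairs.map cross clique))))

cliquesBounded-map :
  {E : Rel V 0ℓ} {E′ : Rel W 0ℓ} {a : V → ℕ} {ω : ℕ} (f : W → V) →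
  (∀ {u v} → E′ u v → E (f u) (f v)) →
  CliquesBounded E a ω → CliquesBounded E′ (a ∘ f) ω
cliquesBounded-map {ω = ω} f hom bounded C clique =
  subst (_≤ ω) (cong sum (sym (map-∘ C)))
    (bounded (map f C) (AllPairsP.map⁺ (AllPairs.map hom clique)))

-- Cliques of maximum weight

module MaximumClique {V : Set} (_≟ⱽ_ : DecidableEquality V) (E : Rel V 0ℓ)
  (E? : Decidable E) (E-sym : Symmetric E) (E-irr : ∀ {u} → ¬ E u u) (a : V → ℕ) where

  open import Data.List.Membership.DecPropositional _≟ⱽ_ using (_∈?_)

  record MaxClique (vs : List V) : Set where
    field
      clique  : List V
      isClique : AllPairs E clique
      inside  : All (_∈ vs) clique
      maximum : ∀ D → AllPairs E D → All (_∈ vs) D → weight a D ≤ weight a clique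
  open MaxClique

  private
    uncons : ∀ {v D} → v ∈ D → AllPairs E D →
             ∃ λ D′ → D ↭ v ∷ D′ × All (E v) D′ × AllPairs E D′
    uncons v∈D clique with ∈-∃++ v∈D
    ... | ys , zs , refl with PermSetoid.AllPairs-resp-↭ (setoid V) E-sym ((λ { refl e → e }) , (λ { refl e → e }))
                                (↭⇒↭ₛ (Perm.shift _ ys zs)) clique
    ...   | adjacent ∷ clique′ = ys ++ zs , Perm.shift _ ys zs , adjacent , clique′

    -- A clique either avoids `v` or consists of `v` and a clique among the neighbours of `v`. The
    -- bound `k` is fuel, because the recursive call on the filtered list is not structural.
    search : ∀ k vs → length vs ≤ k → MaxClique vs
    search k [] _ = record
      { clique = [] ; isClique = [] ; inside = []
      ; maximum = λ { [] _ _ → z≤n ; (_ ∷ _) _ (() ∷ _) } }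
    search (suc k) (v ∷ vs) (s≤s len) = choose (search k vs len)
        (search k (filter (E? v) vs) (≤-trans (length-filter (E? v) vs) len))
      where
      choose : MaxClique vs → MaxClique (filter (E? v) vs) → MaxClique (v ∷ vs)
      choose without with-v = pick (≤-total (weight a (clique without)) (weight a (v ∷ clique with-v)))
        where
        bound : ∀ D → AllPairs E D → All (_∈ v ∷ vs) D →
                weight a D ≤ weight a (clique without) ⊎ weight a D ≤ weight a (v ∷ clique with-v)
        bound D cl D⊆ with v ∈? D
        ... | no v∉D = inj₁ (maximum without D cl (All.tabulate λ x∈D → drop (All.lookup D⊆ x∈D) λ { refl → v∉D x∈D }))
          where
          drop : ∀ {x} → x ∈ v ∷ vs → x ≢ v → x ∈ vs
          drop (here x≡v) x≢v = contradiction x≡v x≢v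
          drop (there x∈) _ = x∈
        ... | yes v∈D with uncons v∈D cl
        ...   | D′ , D↭ , vD′ , cl′ with Perm.All-resp-↭ D↭ D⊆
        ...     | _ ∷ D′⊆ = inj₂ (subst (_≤ weight a (v ∷ clique with-v)) (sym (sum-↭ (Perm.map⁺ a D↭)))
                    (+-monoʳ-≤ (a v) (maximum with-v D′ cl′
                      (All.zipWith (λ { (here refl , e) → contradiction e E-irr
                                      ; (there x∈ , e) → ∈-filter⁺ (E? v) x∈ e }) (D′⊆ , vD′)))))

        pick : weight a (clique without) ≤ weight a (v ∷ clique with-v) ⊎
               weight a (v ∷ clique with-v) ≤ weight a (clique without) → MaxClique (v ∷ vs)
        pick (inj₁ le) = record
          { clique = v ∷ clique with-v
          ; isClique = All.map (proj₂ ∘ ∈-filter⁻ (E? v) {xs = vs}) (inside with-v) ∷ isClique with-v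
          ; inside = here refl ∷ All.map (there ∘ proj₁ ∘ ∈-filter⁻ (E? v) {xs = vs}) (inside with-v)
          ; maximum = λ D cl D⊆ → [ (λ p → ≤-trans p le) , (λ p → p) ]′ (bound D cl D⊆) }
        pick (inj₂ le) = record
          { clique = clique without
          ; isClique = isClique without
          ; inside = All.map there (inside without)
          ; maximum = λ D cl D⊆ → [ (λ p → p) , (λ p → ≤-trans p le) ]′ (bound D cl D⊆) }

  maxClique : ∀ vs → MaxClique vs
  maxClique vs = search (length vs) vs ≤-refl

module Restrict {P : Pred V 0ℓ} (P? : Decidable₁ P) where

  -- Expanding `v` to one vertex or to none keeps its weight on `P` and makes it 0 elsewhere, in the
  -- form that `cliquesBounded-concatMap` accepts.
  restrict : V → List V
  restrict v with P? v
  ... | yes _ = v ∷ []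
  ... | no  _ = []

  restrict-clique : {E : Rel V 0ℓ} → ∀ v → AllPairs E (restrict v)
  restrict-clique v with P? v
  ... | yes _ = [] ∷ []
  ... | no  _ = []

  restrict-cross : {Q : Rel V 0ℓ} → ∀ {u v} → (P u → P v → Q u v) →
                   All (λ x → All (Q x) (restrict v)) (restrict u)
  restrict-cross {u = u} {v} q with P? u | P? v
  ... | yes p | yes p′ = (q p p′ ∷ []) ∷ []
  ... | yes _ | no _   = [] ∷ []
  ... | no _  | _      = []

  weight-restrict : (a : V → ℕ) → ∀ {v} → P v → weight a (restrict v) ≡ a v
  weight-restrict a {v} p with P? v
  ... | yes _ = +-identityʳ (a v)
  ... | no ¬p = contradiction p ¬p

  lift-restrict : (g : ℕ → ℕ) (a : V → ℕ) → ∀ {v c} → P v → c < g (a v) → c < g (weight a (restrict v))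
  lift-restrict g a {v} {c} p = subst (λ x → c < g x) (sym (weight-restrict a p))

  restrict-inside : ∀ v → All P (restrict v)
  restrict-inside v with P? v
  ... | yes p = p ∷ []
  ... | no  _ = []

-- Goodness and its closure properties

data Union {V W : Set} (E : Rel V 0ℓ) (F : Rel W 0ℓ) : Rel (V ⊎ W) 0ℓ where
  left  : ∀ {u v} → E u v → Union E F (inj₁ u) (inj₁ v)
  right : ∀ {u v} → F u v → Union E F (inj₂ u) (inj₂ v)

-- The substituted vertex v is kept, as a twin of the vertices satisfying P;
-- those outside P stay detached from E.
data Substitution {V W : Set} (E : Rel V 0ℓ) (v : V) (F : Rel W 0ℓ) (P : Pred W 0ℓ) : Rel (V ⊎ W) 0ℓ where
  outer  : ∀ {u u′} → E u u′ → Substitution E v F P (inj₁ u) (inj₁ u′)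
  inner  : ∀ {w w′} → F w w′ → Substitution E v F P (inj₂ w) (inj₂ w′)
  out-in : ∀ {u w} → E u v → P w → Substitution E v F P (inj₁ u) (inj₂ w)
  in-out : ∀ {u w} → E u v → P w → Substitution E v F P (inj₂ w) (inj₁ u)

module Assignments (g : ℕ → ℕ) where

  -- Colour c of vertex v is only meaningful for c < g (a v).
  record Assignment {V : Set} (E : Rel V 0ℓ) (a : V → ℕ) (ω : ℕ) : Set where
    field
      colour    : V → ℕ → ℕ
      bounded   : ∀ {v c} → c < g (a v) → colour v c < g ω
      injective : ∀ {v c d} → c < g (a v) → d < g (a v) → colour v c ≡ colour v d → c ≡ d
      separated : ∀ {u v c d} → E u v → c < g (a u) → d < g (a v) → colour u c ≢ colour v d
  open Assignment

  Good : {V : Set} → Rel V 0ℓ → Set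
  Good {V} E = ∀ (a : V → ℕ) ω → CliquesBounded E a ω → Assignment E a ω

  -- Vertices outside the image of `f` receive weight 0: `φ u` lists the preimage of `u`, which has
  -- at most one element.
  good-induced : ∀ {m} {W : Set} {E : Rel (Fin m) 0ℓ} {E′ : Rel W 0ℓ} → DecidableEquality W →
                 (f : Fin m → W) → Injective _≡_ _≡_ f →
                 (∀ {i j} → E i j → E′ (f i) (f j)) → (∀ {i j} → E′ (f i) (f j) → E i j) →
                 Good E′ → Good E
  good-induced {m} {W} {E} {E′} _≟ᵂ_ f f-inj to from good a ω cb = record
    { colour    = colour A ∘ f
    ; bounded   = λ c< → bounded A (lift c<)
    ; injective = λ c< d< → injective A (lift c<) (lift d<)
    ; separated = λ e c< d< → separated A (to e) (lift c<) (lift d<) }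
    where
    preimage : ∀ {u} → Dec (∃ λ i → f i ≡ u) → List (Fin m)
    preimage (yes (i , _)) = i ∷ []
    preimage (no _)        = []

    φ : W → List (Fin m)
    φ u = preimage (any? λ i → f i ≟ᵂ u)

    φ-clique : ∀ u → AllPairs E (φ u)
    φ-clique u with any? (λ i → f i ≟ᵂ u)
    ... | yes _ = [] ∷ []
    ... | no _  = []

    cross : ∀ {u v} → E′ u v → All (λ x → All (E x) (φ v)) (φ u)
    cross {u} {v} e with any? (λ i → f i ≟ᵂ u) | any? (λ i → f i ≟ᵂ v)
    ... | yes (i , refl) | yes (j , refl) = (from e ∷ []) ∷ []
    ... | yes _ | no _ = [] ∷ []
    ... | no _  | _    = []

    weight-φ : ∀ i → weight a (φ (f i)) ≡ a i
    weight-φ i with any? (λ j → f j ≟ᵂ f i)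
    ... | yes (j , eq) = trans (+-identityʳ (a j)) (cong a (f-inj eq))
    ... | no ¬p = contradiction (i , refl) ¬p

    A : Assignment E′ (weight a ∘ φ) ω
    A = good (weight a ∘ φ) ω (cliquesBounded-concatMap φ φ-clique cross cb)

    lift : ∀ {i c} → c < g (a i) → c < g (weight a (φ (f i)))
    lift {i} {c} = subst (λ x → c < g x) (sym (weight-φ i))

  -- No remaining edge joins two levels, so all levels may use the same `g ω` colours. Level `k` is
  -- coloured by the assignment of `E` for the weights that vanish off this level; the part of a
  -- clique of `E` inside the level is a clique of the new relation.
  good-same-level : {V : Set} {E : Rel V 0ℓ} (ℓ : V → ℕ) → Good E → Good (λ u v → E u v × ℓ u ≡ ℓ v)
  good-same-level {V} {E} ℓ good a ω cb = record
    { colour    = λ v → colour (A (ℓ v)) v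
    ; bounded   = λ c< → bounded (A _) (lift refl c<)
    ; injective = λ c< d< → injective (A _) (lift refl c<) (lift refl d<)
    ; separated = λ {u} {v} → sep u v }
    where
    module AtLevel k = Restrict (λ v → ℓ v ≟ k)

    A : ∀ k → Assignment E (weight a ∘ AtLevel.restrict k) ω
    A k = good _ ω (cliquesBounded-concatMap (AtLevel.restrict k) (AtLevel.restrict-clique k)
            (λ e → AtLevel.restrict-cross k (λ p q → e , trans p (sym q))) cb)

    lift : ∀ {k v c} → ℓ v ≡ k → c < g (a v) → c < g (weight a (AtLevel.restrict k v))
    lift = AtLevel.lift-restrict _ g a

    sep : ∀ u v {c d} → E u v × ℓ u ≡ ℓ v → c < g (a u) → d < g (a v) →
          colour (A (ℓ u)) u c ≢ colour (A (ℓ v)) v d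
    sep u v {c} {d} (e , eq) c< d< same =
      separated (A (ℓ u)) e (lift refl c<) (lift (sym eq) d<)
        (trans same (cong (λ k → colour (A k) v d) (sym eq)))

  good-union : {V W : Set} {E : Rel V 0ℓ} {F : Rel W 0ℓ} → Good E → Good F → Good (Union E F)
  good-union {E = E} {F = F} goodE goodF a ω cb = record
    { colour    = λ { (inj₁ v) → colour A v ; (inj₂ w) → colour B w }
    ; bounded   = λ { {inj₁ _} → bounded A ; {inj₂ _} → bounded B }
    ; injective = λ { {inj₁ _} → injective A ; {inj₂ _} → injective B }
    ; separated = λ { (left e) → separated A e ; (right e) → separated B e } }
    where
    A : Assignment E (a ∘ inj₁) ω
    A = goodE _ ω (cliquesBounded-map inj₁ left cb)
    B : Assignment F (a ∘ inj₂) ω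
    B = goodF _ ω (cliquesBounded-map inj₂ right cb)

  module _ (g-mono : ∀ {x y} → x ≤ y → g x ≤ g y) {m n} (E : Rel (Fin m) 0ℓ) (v : Fin m)
    (F : Rel (Fin n) 0ℓ) {P : Pred (Fin n) 0ℓ} (P? : Decidable₁ P)
    (E? : Decidable E) (E-sym : Symmetric E) (E-irr : ∀ {u} → ¬ E u u)
    (F? : Decidable F) (F-sym : Symmetric F) (F-irr : ∀ {u} → ¬ F u u)
    (P-closed : ∀ {w w′} → F w w′ → P w → P w′) where

    private
      S : Rel (Fin m ⊎ Fin n) 0ℓ
      S = Substitution E v F P

      S? : Decidable S
      S? (inj₁ u) (inj₁ u′) = map′ outer (λ { (outer e) → e }) (E? u u′)
      S? (inj₂ w) (inj₂ w′) = map′ inner (λ { (inner e) → e }) (F? w w′)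
      S? (inj₁ u) (inj₂ w) = map′ (λ (e , p) → out-in e p) (λ { (out-in e p) → e , p }) (E? u v ×-dec P? w)
      S? (inj₂ w) (inj₁ u) = map′ (λ (e , p) → in-out e p) (λ { (in-out e p) → e , p }) (E? u v ×-dec P? w)

      S-sym : Symmetric S
      S-sym (outer e)    = outer (E-sym e)
      S-sym (inner e)    = inner (F-sym e)
      S-sym (out-in e p) = in-out e p
      S-sym (in-out e p) = out-in e p

      S-irr : ∀ {x} → ¬ S x x
      S-irr (outer e) = E-irr e
      S-irr (inner e) = F-irr e

      module In  = Restrict P?
      module Out = Restrict (¬? ∘ P?)

    -- The vertex `v` gets the weight of a heaviest clique in the module, and the colours it then
    -- receives from `A` become the palette inside the module, distributed by `B`. Vertices outside
    -- `P` have no neighbours in `E`, and by `P-closed` none in `P`, so `C` colours them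
    -- independently from all `g ω` colours.
    good-substitution : Good E → Good F → Good S
    good-substitution goodE goodF a ω cb = record
      { colour    = colourS
      ; bounded   = λ {x} → boundedS x
      ; injective = λ {x} → injectiveS x
      ; separated = separatedS }
      where
      -- The module: `v` together with its twins. Including `v` makes its new weight at least its
      -- own, so monotonicity of `g` still leaves it enough colours.
      candidates : List (Fin m ⊎ Fin n)
      candidates = inj₁ v ∷ map inj₂ (filter P? (allFin n))

      open MaximumClique (SumP.≡-dec Fin._≟_ Fin._≟_) S S? S-sym S-irr a using (maxClique; module MaxClique)
      module L = MaxClique (maxClique candidates)

      replace : ∀ {u} → Dec (u ≡ v) → List (Fin m ⊎ Fin n)
      replace     (yes _) = L.clique
      replace {u} (no _)  = inj₁ u ∷ []

      φ : Fin m → List (Fin m ⊎ Fin n)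
      φ u = replace (u Fin.≟ v)

      φ-clique : ∀ u → AllPairs S (φ u)
      φ-clique u with u Fin.≟ v
      ... | yes _ = L.isClique
      ... | no _  = [] ∷ []

      E⇒S : ∀ {u x} → E u v → x ∈ candidates → S (inj₁ u) x
      E⇒S e (here refl) = outer e
      E⇒S e (there x∈) with ∈-map⁻ inj₂ x∈
      ... | w , w∈ , refl = out-in e (proj₂ (∈-filter⁻ P? {xs = allFin n} w∈))

      φ-cross : ∀ {u u′} → E u u′ → All (λ x → All (S x) (φ u′)) (φ u)
      φ-cross {u} {u′} e with u Fin.≟ v | u′ Fin.≟ v
      ... | yes refl | yes refl = contradiction e E-irr
      ... | yes refl | no _  = All.map (λ x∈ → S-sym (E⇒S (E-sym e) x∈) ∷ []) L.inside
      ... | no _  | yes refl = All.map (E⇒S e) L.inside ∷ []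
      ... | no _  | no _  = (outer e ∷ []) ∷ []

      A : Assignment E (weight a ∘ φ) ω
      A = goodE _ ω (cliquesBounded-concatMap φ φ-clique φ-cross cb)

      weight-φ-v : weight a (φ v) ≡ weight a L.clique
      weight-φ-v with v Fin.≟ v
      ... | yes _ = refl
      ... | no v≢v = contradiction refl v≢v

      a≤weight-φ : ∀ u → a (inj₁ u) ≤ weight a (φ u)
      a≤weight-φ u with u Fin.≟ v
      ... | yes refl = ≤-trans (m≤m+n _ 0) (L.maximum (inj₁ v ∷ []) ([] ∷ []) (here refl ∷ []))
      ... | no _     = m≤m+n _ 0

      -- The part inside `P` of a clique of `F` is a clique of candidates, hence no heavier than
      -- `L.clique`.
      In-bounded : CliquesBounded F (weight (a ∘ inj₂) ∘ In.restrict) (weight a L.clique)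
      In-bounded D clique = subst (_≤ weight a L.clique)
        (trans (cong sum (sym (map-∘ D′))) (weight-concatMap (a ∘ inj₂) In.restrict D))
        (L.maximum (map inj₂ D′)
          (AllPairsP.map⁺ (AllPairs.map inner (AllPairsP.concat⁺
            (AllP.map⁺ (All.universal In.restrict-clique D))
            (AllPairsP.map⁺ (AllPairs.map (λ f → In.restrict-cross (λ _ _ → f)) clique)))))
          (AllP.map⁺ (All.map (λ p → there (∈-map⁺ inj₂ (∈-filter⁺ P? (∈-allFin _) p)))
            (AllP.concat⁺ (AllP.map⁺ (All.universal In.restrict-inside D))))))
        where D′ = concatMap In.restrict D

      B : Assignment F (weight (a ∘ inj₂) ∘ In.restrict) (weight a L.clique)
      B = goodF _ _ In-bounded

      C : Assignment F (weight (a ∘ inj₂) ∘ Out.restrict) ω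
      C = goodF _ ω (cliquesBounded-concatMap Out.restrict Out.restrict-clique
            (λ f → Out.restrict-cross (λ _ _ → f)) (cliquesBounded-map inj₂ inner cb))

      liftE : ∀ {u c} → c < g (a (inj₁ u)) → c < g (weight a (φ u))
      liftE {u} c< = <-≤-trans c< (g-mono (a≤weight-φ u))

      liftIn : ∀ {w c} → P w → c < g (a (inj₂ w)) → c < g (weight (a ∘ inj₂) (In.restrict w))
      liftIn = In.lift-restrict g _

      liftOut : ∀ {w c} → ¬ P w → c < g (a (inj₂ w)) → c < g (weight (a ∘ inj₂) (Out.restrict w))
      liftOut = Out.lift-restrict g _

      colourB<  : ∀ {w c} → P w → c < g (a (inj₂ w)) → colour B w c < g (weight a (φ v))
      colourB< {w} {c} p c< = subst (λ x → colour B w c < g x) (sym weight-φ-v) (bounded B (liftIn p c<))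

      colourS : Fin m ⊎ Fin n → ℕ → ℕ
      colourS (inj₁ u) c = colour A u c
      colourS (inj₂ w) c with P? w
      -- `B` selects an index below `g (weight a L.clique)`, and `A` turns it into the colour of `v`
      -- with that index. Any `u` adjacent to `v` avoids all of these colours.
      ... | yes _ = colour A v (colour B w c)
      ... | no _  = colour C w c

      boundedS : ∀ x {c} → c < g (a x) → colourS x c < g ω
      boundedS (inj₁ u) c< = bounded A (liftE c<)
      boundedS (inj₂ w) c< with P? w
      ... | yes p = bounded A (colourB< p c<)
      ... | no ¬p = bounded C (liftOut ¬p c<)

      injectiveS : ∀ x {c d} → c < g (a x) → d < g (a x) → colourS x c ≡ colourS x d → c ≡ d
      injectiveS (inj₁ u) c< d< = injective A (liftE c<) (liftE d<)
      injectiveS (inj₂ w) c< d< eq with P? w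
      ... | yes p = injective B (liftIn p c<) (liftIn p d<) (injective A (colourB< p c<) (colourB< p d<) eq)
      ... | no ¬p = injective C (liftOut ¬p c<) (liftOut ¬p d<) eq

      separated-out-in : ∀ {u w c d} → E u v → P w → c < g (a (inj₁ u)) → d < g (a (inj₂ w)) →
                         colourS (inj₁ u) c ≢ colourS (inj₂ w) d
      separated-out-in {w = w} e p c< d< with P? w
      ... | yes _ = separated A e (liftE c<) (colourB< p d<)
      ... | no ¬p = contradiction p ¬p

      separatedS : ∀ {x y c d} → S x y → c < g (a x) → d < g (a y) → colourS x c ≢ colourS y d
      separatedS (outer e) c< d< = separated A e (liftE c<) (liftE d<)
      separatedS (out-in e p) c< d< = separated-out-in e p c< d<
      separatedS (in-out e p) c< d< = separated-out-in e p d< c< ∘ sym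
      separatedS (inner {w} {w′} f) c< d< with P? w | P? w′
      ... | yes p | yes p′ = separated B f (liftIn p c<) (liftIn p′ d<)
                           ∘ injective A (colourB< p c<) (colourB< p′ d<)
      ... | no ¬p | no ¬p′ = separated C f (liftOut ¬p c<) (liftOut ¬p′ d<)
      ... | yes p | no ¬p′ = contradiction (P-closed f p) ¬p′
      ... | no ¬p | yes p′ = contradiction (P-closed (F-sym f) p′) ¬p

-- Goodness of the graphs in 𝒢

Adj : (G : Graph) → Rel (Fin (n G)) 0ℓ
Adj G u v = adj G u v ≡ true

adj-symmetric : ∀ G → Symmetric (Adj G)
adj-symmetric G {u} {v} e = trans (adj-sym G v u) e

adj-irreflexive : ∀ G {u} → ¬ Adj G u u
adj-irreflexive G {u} e with () ← trans (sym e) (adj-irr G u)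

adj? : ∀ G → Decidable (Adj G)
adj? G u v = adj G u v Bool.≟ true

AllPairs-lookup : {R : Rel V 0ℓ} → Symmetric R → ∀ {xs} → AllPairs R xs → ∀ {i j} → i ≢ j →
                  R (lookup xs i) (lookup xs j)
AllPairs-lookup R-sym (_ ∷ _)  {Fin.zero}  {Fin.zero}  i≢j = contradiction refl i≢j
AllPairs-lookup R-sym (r ∷ _)  {Fin.zero}  {Fin.suc j} _   = All.lookup r (∈-lookup j)
AllPairs-lookup R-sym (r ∷ _)  {Fin.suc i} {Fin.zero}  _   = R-sym (All.lookup r (∈-lookup i))
AllPairs-lookup R-sym (_ ∷ rs) {Fin.suc i} {Fin.suc j} i≢j = AllPairs-lookup R-sym rs (i≢j ∘ cong Fin.suc)

AllPairs-lookup-injective : {R : Rel V 0ℓ} → Symmetric R → (∀ {u} → ¬ R u u) →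
                            ∀ {xs} → AllPairs R xs → Injective _≡_ _≡_ (lookup xs)
AllPairs-lookup-injective {R = R} R-sym R-irr Rxs {i} {j} eq with i Fin.≟ j
... | yes i≡j = i≡j
... | no  i≢j = contradiction (subst (R _) (sym eq) (AllPairs-lookup R-sym Rxs i≢j)) R-irr

length*≤weight : (a : V → ℕ) → ∀ {t C} → All (λ v → t ≤ a v) C → length C * t ≤ weight a C
length*≤weight a []       = z≤n
length*≤weight a (p ∷ ps) = +-mono-≤ p (length*≤weight a ps)

-- The weights `const 1` count vertices. The hypothesis of χ-boundedness yields a colouring only
-- once a clique number is exhibited.
maximumClique : ∀ G → ∃ λ C → AllPairs (Adj G) C × IsCliqueNumber G (length C)
maximumClique G = clique , isClique , (lookup clique , AllPairs-lookup-injective (adj-symmetric G) (adj-irreflexive G) isClique , λ _ _ → AllPairs-lookup (adj-symmetric G) isClique)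
                , λ k (f , _ , pairwise) → subst₂ _≤_
                    (trans (weight-const1 (tabulate f)) (length-tabulate f)) (weight-const1 clique)
                    (maximum (tabulate f) (AllPairsP.tabulate⁺ (pairwise _ _)) (All.universal ∈-allFin _))
  where
  open MaximumClique Fin._≟_ (Adj G) (adj? G) (adj-symmetric G) (adj-irreflexive G) (const 1)
  open MaxClique (maxClique (allFin (n G)))

-- Consecutive blocks of colours and the counting inequality

partialSum : (ℕ → ℕ) → ℕ → ℕ
partialSum D zero    = 0
partialSum D (suc i) = partialSum D i + D i

partialSum-mono : ∀ D {i j} → i ≤ j → partialSum D i ≤ partialSum D j
partialSum-mono D {i} {j} i≤j = subst (λ x → partialSum D i ≤ partialSum D x) (m∸n+n≡m i≤j) (go (j ∸ i))
  where
  go : ∀ d → partialSum D i ≤ partialSum D (d + i)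
  go zero    = ≤-refl
  go (suc d) = ≤-trans (go d) (m≤m+n _ _)

partialSum-const : ∀ d m → partialSum (const d) m ≡ m * d
partialSum-const d zero    = refl
partialSum-const d (suc m) = trans (+-comm _ d) (cong (d +_) (partialSum-const d m))

-- The naturals are cut into consecutive blocks, block `i` having `D i` elements;
-- `partialSum D i + r` is element `r` of block `i`.
module Blocks (D : ℕ → ℕ) where

  offset< : ∀ {i j r} → r < D i → i < j → partialSum D i + r < partialSum D j
  offset< {i} r< i<j = <-≤-trans (+-monoʳ-< (partialSum D i) r<) (partialSum-mono D i<j)

  offset-injective : ∀ {i j r s} → r < D i → s < D j →
                     partialSum D i + r ≡ partialSum D j + s → i ≡ j × r ≡ s
  offset-injective {i} {j} r< s< eq with <-cmp i j
  ... | tri< i<j _ _  = contradiction eq (<⇒≢ (<-≤-trans (offset< r< i<j) (m≤m+n _ _)))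
  ... | tri≈ _ refl _ = refl , +-cancelˡ-≡ (partialSum D i) _ _ eq
  ... | tri> _ _ j<i  = contradiction (sym eq) (<⇒≢ (<-≤-trans (offset< s< j<i) (m≤m+n _ _)))

  locate : ℕ → ℕ → ℕ × ℕ
  -- A junk value: nothing lies below `partialSum D 0`.
  locate zero    c = 0 , 0
  locate (suc a) c with c <? partialSum D a
  ... | yes _ = locate a c
  ... | no  _ = a , c ∸ partialSum D a

  locate-spec : ∀ a {c} → c < partialSum D a → let i , r = locate a c in
                i < a × r < D i × partialSum D i + r ≡ c
  locate-spec (suc a) {c} c< with c <? partialSum D a
  ... | yes c<′ = let i< , rest = locate-spec a c<′ in m<n⇒m<1+n i< , rest
  ... | no  c≮  = n<1+n a
                , +-cancelˡ-< (partialSum D a) _ _ (subst (_< partialSum D (suc a)) (sym (m+[n∸m]≡n (≮⇒≥ c≮))) c<)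
                , m+[n∸m]≡n (≮⇒≥ c≮)

^-distribʳ-* : ∀ k m n → (m * n) ^ k ≡ m ^ k * n ^ k
^-distribʳ-* zero    m n = refl
^-distribʳ-* (suc k) m n =
  trans (cong (m * n *_) (^-distribʳ-* k m n)) ([m*n]*[o*p]≡[m*o]*[n*p] m n (m ^ k) (n ^ k))

power : ℕ → ℕ → ℕ
power k i = suc i ^ (k + k)

powerSum : ℕ → ℕ → ℕ
powerSum k = partialSum (power k)

palette : ℕ → ℕ → ℕ → ℕ
palette k ω i = (ω / suc i) ^ k

-- The product of `palette k ω i` and `power k i`, written as a partial sum so that `Blocks` can
-- number the copies of each threshold colour.
palettes : ℕ → ℕ → ℕ → ℕ
palettes k ω i = partialSum (const (power k i)) (palette k ω i)

-- With `j = suc i`, the left side is the `k`-th power of `ω / j * j * j`, which is at most `ω * j`,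
-- hence at most `2 * t * j` and so at most `(j + t) * (j + t)`.
palettes≤power : ∀ k {ω t} → ω ≤ t + t → ∀ i → palettes k ω i ≤ power k (i + t)
palettes≤power k {ω} {t} ω≤2t i = begin
  partialSum (const (j ^ (k + k))) ((ω / j) ^ k) ≡⟨ partialSum-const (j ^ (k + k)) ((ω / j) ^ k) ⟩
  (ω / j) ^ k * j ^ (k + k)      ≡⟨ cong ((ω / j) ^ k *_) (^-distribˡ-+-* j k k) ⟩
  (ω / j) ^ k * (j ^ k * j ^ k)  ≡⟨ *-assoc ((ω / j) ^ k) _ _ ⟨
  (ω / j) ^ k * j ^ k * j ^ k    ≡⟨ cong (_* j ^ k) (^-distribʳ-* k (ω / j) j) ⟨
  (ω / j * j) ^ k * j ^ k        ≡⟨ ^-distribʳ-* k (ω / j * j) j ⟨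
  (ω / j * j * j) ^ k            ≤⟨ ^-monoˡ-≤ k ωj≤y² ⟩
  (y * y) ^ k                    ≡⟨ ^-distribʳ-* k y y ⟩
  y ^ k * y ^ k                  ≡⟨ ^-distribˡ-+-* y k k ⟨
  y ^ (k + k)                    ∎
  where
  open ≤-Reasoning
  j y : ℕ
  j = suc i
  y = j + t
  ωj≤y² : ω / j * j * j ≤ y * y
  ωj≤y² = begin
    ω / j * j * j     ≤⟨ *-monoˡ-≤ j (≤-trans (m/n*n≤m ω j) ω≤2t) ⟩
    (t + t) * j       ≡⟨ *-distribʳ-+ j t t ⟩
    t * j + t * j     ≡⟨ cong (t * j +_) (*-comm t j) ⟩
    t * j + j * t     ≤⟨ +-mono-≤ (*-monoʳ-≤ t (m≤m+n j t)) (*-monoʳ-≤ j (m≤n+m t j)) ⟩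
    t * y + j * y     ≡⟨ +-comm (t * y) _ ⟩
    j * y + t * y     ≡⟨ *-distribʳ-+ y j t ⟨
    y * y ∎

-- The palettes of the first `x` thresholds leave room for `powerSum k t` further colours. With
-- `x + t = ω` and `t` the larger of `a v` and `ω ∸ a v`, this bounds the colours of light and of
-- heavy vertices.
palettes+powerSum≤powerSum : ∀ k {ω t} → ω ≤ t + t → ∀ x →
  partialSum (palettes k ω) x + powerSum k t ≤ powerSum k (x + t)
palettes+powerSum≤powerSum k ω≤2t zero = ≤-refl
palettes+powerSum≤powerSum k {ω} {t} ω≤2t (suc x) = begin
  F x + palettes k ω x + powerSum k t   ≡⟨ +-assoc (F x) _ _ ⟩
  F x + (palettes k ω x + powerSum k t) ≡⟨ cong (F x +_) (+-comm (palettes k ω x) _) ⟩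
  F x + (powerSum k t + palettes k ω x) ≡⟨ +-assoc (F x) _ _ ⟨
  F x + powerSum k t + palettes k ω x   ≤⟨ +-mono-≤ (palettes+powerSum≤powerSum k ω≤2t x) (palettes≤power k ω≤2t x) ⟩
  powerSum k (x + t) + power k (x + t)  ∎
  where
  open ≤-Reasoning
  F : ℕ → ℕ
  F = partialSum (palettes k ω)

-- Since thresholds start at 1, index i stands for the threshold i + 1.
record ThresholdColouring (k : ℕ) (E : Rel V 0ℓ) (a : V → ℕ) (ω i : ℕ) : Set where
  field
    colour    : V → ℕ
    bounded   : ∀ {v} → i < a v → colour v < palette k ω i
    separated : ∀ {u v} → E u v → i < a u → i < a v → colour u ≢ colour v

-- From threshold colourings to goodness

module _ (k : ℕ) where
  open Assignments (powerSum k)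

  thresholdColourings⇒assignment : {E : Rel V 0ℓ} {a : V → ℕ} {ω : ℕ} → Symmetric E →
    CliquesBounded E a ω → (∀ i → ThresholdColouring k E a ω i) → Assignment E a ω
  thresholdColourings⇒assignment {V = V} {E} {a} {ω} E-sym cb thresholds = record
    { colour    = λ v → colourOf v (a v ≤? rest v)
    ; bounded   = λ {v} → boundedOf v (a v ≤? rest v)
    ; injective = λ {v} → injectiveOf v (a v ≤? rest v)
    ; separated = λ {u} {v} → separatedOf u v (a u ≤? rest u) (a v ≤? rest v) }
    where
    module T i = ThresholdColouring (thresholds i)
    module G = Blocks (power k)
    module F = Blocks (palettes k ω)
    module P i = Blocks (const (power k i))

    g F : ℕ → ℕ
    g = powerSum k
    F = partialSum (palettes k ω)

    rest : V → ℕ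
    rest v = ω ∸ a v

    rest+a : ∀ v → rest v + a v ≡ ω
    rest+a v = m∸n+n≡m (subst (_≤ ω) (+-identityʳ (a v)) (cb (v ∷ []) ([] ∷ [])))

    a≤rest : ∀ {u v} → E u v → a u ≤ rest v
    a≤rest {u} {v} e = +-cancelʳ-≤ (a v) _ _ (subst (a u + a v ≤_) (sym (rest+a v))
      (subst (_≤ ω) (cong (a u +_) (+-identityʳ (a v))) (cb (u ∷ v ∷ []) ((e ∷ []) ∷ [] ∷ []))))

    local : V → ℕ → ℕ → ℕ
    local v i r = partialSum (const (power k i)) (T.colour i v) + r

    -- `G.locate (a v)` returns indices `i < a v`, exactly those thresholds at which `v` has a
    -- proper colour. Inside palette `i`, the offset `r` picks a copy of this colour.
    code : V → ℕ × ℕ → ℕ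
    code v (i , r) = F i + local v i r

    local< : ∀ {v i r} → i < a v → r < power k i → local v i r < palettes k ω i
    local< {v} {i} i< r< = P.offset< i {i = T.colour i v} {j = palette k ω i} r< (T.bounded i i<)

    code< : ∀ v {c} → c < g (a v) → code v (G.locate (a v) c) < F (a v)
    code< v c< with G.locate-spec (a v) c<
    ... | i< , r< , _ = F.offset< (local< i< r<) i<

    colourOf : ∀ v → Dec (a v ≤ rest v) → ℕ → ℕ
    colourOf v (yes _) c = code v (G.locate (a v) c)
    colourOf v (no _)  c = F (rest v) + c

    boundedOf : ∀ v d {c} → c < g (a v) → colourOf v d c < g ω
    boundedOf v (yes a≤) c< = <-≤-trans (code< v c<) (≤-trans (m≤m+n _ _)
      (subst (λ x → F (a v) + g (rest v) ≤ g x) (trans (+-comm (a v) _) (rest+a v))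
        (palettes+powerSum≤powerSum k (subst (_≤ rest v + rest v) (rest+a v) (+-monoʳ-≤ (rest v) a≤)) (a v))))
    boundedOf v (no a≰) c< = <-≤-trans (+-monoʳ-< (F (rest v)) c<)
      (subst (λ x → F (rest v) + g (a v) ≤ g x) (rest+a v)
        (palettes+powerSum≤powerSum k (subst (_≤ a v + a v) (rest+a v) (+-monoˡ-≤ (a v) (≰⇒≥ a≰))) (rest v)))

    injectiveOf : ∀ v d {c c′} → c < g (a v) → c′ < g (a v) → colourOf v d c ≡ colourOf v d c′ → c ≡ c′
    injectiveOf v (yes _) {c} {c′} c< c′< eq
      with G.locate (a v) c | G.locate-spec (a v) c< | G.locate (a v) c′ | G.locate-spec (a v) c′<
    ... | i , r | i< , r< , refl | i′ , r′ | i′< , r′< , refl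
      with F.offset-injective (local< i< r<) (local< i′< r′<) eq
    ...   | refl , eq′ = cong (g i +_) (+-cancelˡ-≡ (partialSum (const (power k i)) (T.colour i v)) _ _ eq′)
    injectiveOf v (no _) c< c′< eq = +-cancelˡ-≡ (F (rest v)) _ _ eq

    -- The colours of `u` end below `F (a u)`, and `a u ≤ rest v` because the edge is a clique of
    -- weight at most `ω`.
    small≢large : ∀ {u v c d} → E u v → c < g (a u) → code u (G.locate (a u) c) ≢ F (rest v) + d
    small≢large {u} {v} e c< = <⇒≢ (<-≤-trans (code< u c<)
      (≤-trans (partialSum-mono (palettes k ω) (a≤rest e)) (m≤m+n _ _)))

    separatedOf : ∀ u v d d′ {c c′} → E u v → c < g (a u) → c′ < g (a v) →
                  colourOf u d c ≢ colourOf v d′ c′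
    separatedOf u v (yes _) (yes _) {c} {c′} e c< c′< eq
      with G.locate (a u) c | G.locate-spec (a u) c< | G.locate (a v) c′ | G.locate-spec (a v) c′<
    ... | i , r | i< , r< , _ | i′ , r′ | i′< , r′< , _
      with F.offset-injective (local< i< r<) (local< i′< r′<) eq
    ...   | refl , eq′ = T.separated i e i< i′< (proj₁ (P.offset-injective i r< r′< eq′))
    separatedOf u v (yes _) (no _) e c< c′< = small≢large e c<
    separatedOf u v (no _) (yes _) e c< c′< = small≢large (E-sym e) c′< ∘ sym
    -- Two heavy vertices cannot be adjacent: `a u ≤ rest v < a v ≤ rest u < a u`.
    separatedOf u v (no a≰) (no a≰′) e _ _ _ = <-irrefl refl
      (<-≤-trans (≰⇒> a≰) (≤-trans (a≤rest e) (≤-trans (<⇒≤ (≰⇒> a≰′)) (a≤rest (E-sym e)))))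

  -- For threshold `suc i`, the χ-bound is applied to the subgraph induced by the vertices of weight
  -- at least `suc i`. A clique on `w` of them weighs at least `w * suc i`, so `w ≤ ω / suc i` and
  -- `f w` is at most `palette k ω i`.
  hereditarilyColourable⇒good : (G : Graph) (f : ℕ → ℕ) → (∀ x → 2 ≤ x → f x ≤ x ^ k) →
    (∀ {m} (ι : Fin m → Fin (n G)) → Injective _≡_ _≡_ ι →
      ∀ w → IsCliqueNumber (induced G ι) w → Colorable (induced G ι) (f w)) →
    Good (Adj G)
  hereditarilyColourable⇒good G f f≤ χ-bounded a ω cb =
    thresholdColourings⇒assignment (adj-symmetric G) cb threshold
    where
    module _ (i : ℕ) where
      heavy : List (Fin (n G))
      heavy = filter (λ v → i <? a v) (allFin (n G))

      ι : Fin (length heavy) → Fin (n G)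
      ι = lookup heavy

      ι-injective : Injective _≡_ _≡_ ι
      ι-injective = AllPairs-lookup-injective (_∘ sym) (λ u≢u → u≢u refl)
        (AllPairsP.filter⁺ (λ v → i <? a v) (allFin⁺ (n G)))

      H : Graph
      H = induced G ι

      C = proj₁ (maximumClique H)
      C-clique = proj₁ (proj₂ (maximumClique H))
      C-number = proj₂ (proj₂ (maximumClique H))

      w≤ : length C ≤ ω / suc i
      w≤ = subst (_≤ ω / suc i) (m*n/n≡m (length C) (suc i)) (/-monoˡ-≤ (suc i) (≤-trans
        (length*≤weight (a ∘ ι) (All.universal (λ x → proj₂ (∈-filter⁻ (λ v → i <? a v) {xs = allFin (n G)} (∈-lookup x))) C))
        (cliquesBounded-map ι (λ e → e) cb C C-clique)))

      position : ∀ {v} → i < a v → Fin (length heavy)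
      position i< = index (∈-filter⁺ (λ v → i <? a v) (∈-allFin _) i<)

      ι-position : ∀ {v} (i< : i < a v) → v ≡ ι (position i<)
      ι-position i< = AnyP.lookup-index (∈-filter⁺ (λ v → i <? a v) (∈-allFin _) i<)

      position-adj : ∀ {u v} (p : i < a u) (q : i < a v) → Adj G u v → Adj H (position p) (position q)
      position-adj p q = subst₂ (Adj G) (ι-position p) (ι-position q)

      threshold : ThresholdColouring k (Adj G) a ω i
      threshold with 2 ≤? length C
      ... | yes 2≤w = record
        { colour = λ v → colourOf (i <? a v)
        ; bounded = λ {v} → boundedOf (i <? a v)
        ; separated = λ {u} {v} → separatedOf (i <? a u) (i <? a v) }
        where
        colouring : Colorable H (f (length C))
        colouring = χ-bounded ι ι-injective (length C) C-number
        colourOf : ∀ {v} → Dec (i < a v) → ℕ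
        colourOf (yes i<) = toℕ (proj₁ colouring (position i<))
        -- A default: the conditions on a threshold colouring concern only vertices with `i < a v`.
        colourOf (no _)   = 0
        boundedOf : ∀ {v} (d : Dec (i < a v)) → i < a v → colourOf d < palette k ω i
        boundedOf (yes i<) _ = <-≤-trans (toℕ<n _) (≤-trans (f≤ _ 2≤w) (^-monoˡ-≤ k w≤))
        boundedOf (no i≮) i< = contradiction i< i≮
        separatedOf : ∀ {u v} (d : Dec (i < a u)) (d′ : Dec (i < a v)) → Adj G u v →
                      i < a u → i < a v → colourOf d ≢ colourOf d′
        separatedOf (yes p) (yes q) e _ _ eq = proj₂ colouring _ _ (position-adj p q e) (toℕ-injective eq)
        separatedOf (no i≮) _ e i< _ _ = i≮ i<
        separatedOf _ (no i≮) e _ i< _ = i≮ i<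
      ... | no 2≰w = record
        { colour = const 0
        ; bounded = λ {v} i< → m^n>0 (ω / suc i) {{>-nonZero (m≥n⇒m/n>0 (≤-trans i< (a≤ω v)))}} k
        ; separated = λ e p q _ → 2≰w (proj₂ C-number 2 (edge (position-adj p q e))) }
        where
        a≤ω : ∀ v → a v ≤ ω
        a≤ω v = subst (_≤ ω) (+-identityʳ (a v)) (cb (v ∷ []) ([] ∷ []))
        edge : ∀ {x y} → Adj H x y → HasClique H 2
        edge {x} {y} e = lookup (x ∷ y ∷ [])
          , AllPairs-lookup-injective (adj-symmetric H) (adj-irreflexive H) pair
          , λ _ _ → AllPairs-lookup (adj-symmetric H) pair
          where
          pair : AllPairs (Adj H) (x ∷ y ∷ [])
          pair = (e ∷ []) ∷ [] ∷ []

-- Layerings of the graphs in the closure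

skip-injective : ∀ {k} (v : Fin k) {i j} → skip v i ≡ skip v j → i ≡ j
skip-injective {suc k} v = punchIn-injective v _ _

skip≢ : ∀ {k} (v : Fin k) {i} → skip v i ≢ v
skip≢ {suc k} v = punchInᵢ≢i v _

splitAt-injective : ∀ m {n} {i j : Fin (m + n)} → splitAt m i ≡ splitAt m j → i ≡ j
splitAt-injective m {n} {i} {j} eq =
  trans (sym (join-splitAt m n i)) (trans (cong (Fin.join m n) eq) (join-splitAt m n j))

swapSides : ∀ m n → Fin (m + n) → Fin (n + m)
swapSides m n = Fin.join n m ∘ swap ∘ splitAt m

splitAt-swapSides : ∀ m n i → splitAt n (swapSides m n i) ≡ swap (splitAt m i)
splitAt-swapSides m n i = splitAt-join n m (swap (splitAt m i))

swapSides-swapSides : ∀ m n i → swapSides n m (swapSides m n i) ≡ i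
swapSides-swapSides m n i = splitAt-injective m
  (trans (splitAt-swapSides n m (swapSides m n i))
    (trans (cong swap (splitAt-swapSides m n i)) (SumP.swap-involutive (splitAt m i))))

swapSides-injective : ∀ m n → Injective _≡_ _≡_ (swapSides m n)
swapSides-injective m n {i} {j} eq =
  trans (sym (swapSides-swapSides m n i)) (trans (cong (swapSides n m) eq) (swapSides-swapSides m n j))

-- Induced embeddings, and the 1-join as a substitution

record _↪_ (H G : Graph) : Set where
  field
    to        : Fin (n H) → Fin (n G)
    injective : Injective _≡_ _≡_ to
    preserve  : ∀ i j → adj H i j ≡ adj G (to i) (to j)

-- Allows a root in the second graph to be treated as one in the first.
oneJoin-swap : ∀ G v H w → oneJoin G v H w ↪ oneJoin H w G v
oneJoin-swap G v H w = record
  { to = swapSides a b ; injective = swapSides-injective a b ; preserve = preserve }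
  where
  a = pred (n G)
  b = pred (n H)
  preserve : ∀ i j → adj (oneJoin G v H w) i j ≡ adj (oneJoin H w G v) (swapSides a b i) (swapSides a b j)
  preserve i j rewrite splitAt-swapSides a b i | splitAt-swapSides a b j with splitAt a i | splitAt a j
  ... | inj₁ _ | inj₁ _ = refl
  ... | inj₁ x | inj₂ y = ∧-comm (adj G v (skip v x)) (adj H w (skip w y))
  ... | inj₂ y | inj₁ x = ∧-comm (adj G v (skip v x)) (adj H w (skip w y))
  ... | inj₂ _ | inj₂ _ = refl

disjointUnion-swap : ∀ G H → disjointUnion G H ↪ disjointUnion H G
disjointUnion-swap G H = record
  { to = swapSides a b ; injective = swapSides-injective a b ; preserve = preserve }
  where
  a = n G
  b = n H
  preserve : ∀ i j → adj (disjointUnion G H) i j ≡ adj (disjointUnion H G) (swapSides a b i) (swapSides a b j)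
  preserve i j rewrite splitAt-swapSides a b i | splitAt-swapSides a b j with splitAt a i | splitAt a j
  ... | inj₁ _ | inj₁ _ = refl
  ... | inj₁ _ | inj₂ _ = refl
  ... | inj₂ _ | inj₁ _ = refl
  ... | inj₂ _ | inj₂ _ = refl

module _ (G : Graph) (v : Fin (n G)) (H : Graph) (w : Fin (n H)) where

  -- Places the 1-join, as an induced subgraph, into a substitution that still contains `v` and `w`.
  sides : Fin (n (oneJoin G v H w)) → Fin (n G) ⊎ Fin (n H)
  sides = Sum.map (skip v) (skip w) ∘ splitAt (pred (n G))

  sides-injective : Injective _≡_ _≡_ sides
  sides-injective {i} {j} = splitAt-injective (pred (n G)) ∘ map-injective _ _
    where
    map-injective : ∀ x y → Sum.map (skip v) (skip w) x ≡ Sum.map (skip v) (skip w) y → x ≡ y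
    map-injective (inj₁ _) (inj₁ _) eq = cong inj₁ (skip-injective v (SumP.inj₁-injective eq))
    map-injective (inj₂ _) (inj₂ _) eq = cong inj₂ (skip-injective w (SumP.inj₂-injective eq))

  sides≢ : ∀ i → sides i ≢ inj₂ w
  sides≢ i eq with splitAt (pred (n G)) i
  ... | inj₂ _ = skip≢ w (SumP.inj₂-injective eq)

  Joined : Rel (Fin (n G) ⊎ Fin (n H)) 0ℓ
  Joined = Substitution (Adj G) v (Adj H) (Adj H w)

  ∧-true : ∀ {x y} → x ∧ y ≡ true → x ≡ true × y ≡ true
  ∧-true {true} {true} _ = refl , refl

  adj⇒joined : ∀ i j → Adj (oneJoin G v H w) i j → Joined (sides i) (sides j)
  adj⇒joined i j e with splitAt (pred (n G)) i | splitAt (pred (n G)) j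
  ... | inj₁ _ | inj₁ _ = outer e
  ... | inj₂ _ | inj₂ _ = inner e
  ... | inj₁ _ | inj₂ _ = let e₁ , e₂ = ∧-true e in out-in (adj-symmetric G e₁) e₂
  ... | inj₂ _ | inj₁ _ = let e₁ , e₂ = ∧-true e in in-out (adj-symmetric G e₁) e₂

  joined⇒adj : ∀ i j → Joined (sides i) (sides j) → Adj (oneJoin G v H w) i j
  joined⇒adj i j s with splitAt (pred (n G)) i | splitAt (pred (n G)) j
  joined⇒adj i j (outer e)    | inj₁ _ | inj₁ _ = e
  joined⇒adj i j (inner e)    | inj₂ _ | inj₂ _ = e
  joined⇒adj i j (out-in e p) | inj₁ _ | inj₂ _ = cong₂ _∧_ (adj-symmetric G e) p
  joined⇒adj i j (in-out e p) | inj₂ _ | inj₁ _ = cong₂ _∧_ (adj-symmetric G e) p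

module _ (G H : Graph) where

  adj⇒union : ∀ i j → Adj (disjointUnion G H) i j →
              Union (Adj G) (Adj H) (splitAt (n G) i) (splitAt (n G) j)
  adj⇒union i j e with splitAt (n G) i | splitAt (n G) j
  ... | inj₁ _ | inj₁ _ = left e
  ... | inj₂ _ | inj₂ _ = right e

  union⇒adj : ∀ i j → Union (Adj G) (Adj H) (splitAt (n G) i) (splitAt (n G) j) →
              Adj (disjointUnion G H) i j
  union⇒adj i j u with splitAt (n G) i | splitAt (n G) j
  union⇒adj i j (left e)  | inj₁ _ | inj₁ _ = e
  union⇒adj i j (right e) | inj₂ _ | inj₂ _ = e

parity : ℕ → Fin 2
parity zero    = Fin.zero
parity (suc i) = Fin.opposite (parity i)

parity-suc : ∀ i → parity (suc i) ≢ parity i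
parity-suc i eq with parity i
parity-suc i () | Fin.zero
parity-suc i () | Fin.suc Fin.zero

-- Hence an edge of a layered graph whose ends share a parity lies inside one layer.
same-parity : ∀ {i j} → i ≤ suc j → j ≤ suc i → parity i ≡ parity j → i ≡ j
same-parity {i} {j} i≤ j≤ eq with m≤n⇒m<n∨m≡n i≤ | m≤n⇒m<n∨m≡n j≤
... | inj₂ refl | _         = contradiction eq (parity-suc j)
... | _         | inj₂ refl = contradiction (sym eq) (parity-suc i)
... | inj₁ (s≤s i≤j) | inj₁ (s≤s j≤i) = ≤-antisym i≤j j≤i

module _ (k : ℕ) where
  open Assignments (powerSum k)

  -- By symmetry of `Adj G`, `step` bounds the difference of layers in both directions.
  record Layering (G : Graph) : Set where
    field
      layer : Fin (n G) → ℕ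
      step  : ∀ {u v} → Adj G u v → layer u ≤ suc (layer v)

    SameLayer : Rel (Fin (n G)) 0ℓ
    SameLayer u v = Adj G u v × layer u ≡ layer v

    field
      good  : Good SameLayer

    sameLayer? : Decidable SameLayer
    sameLayer? u v = adj? G u v ×-dec (layer u ≟ layer v)

    sameLayer-symmetric : Symmetric SameLayer
    sameLayer-symmetric (e , eq) = adj-symmetric G e , sym eq

    sameLayer-irreflexive : ∀ {u} → ¬ SameLayer u u
    sameLayer-irreflexive (e , _) = adj-irreflexive G e

  record RootedLayering (G : Graph) (r : Fin (n G)) : Set where
    field
      layering : Layering G
    open Layering layering public
    field
      layer-root : layer r ≡ 0
      layer≡0    : ∀ {u} → layer u ≡ 0 → u ≡ r
      layer-adj  : ∀ {u} → Adj G r u → layer u ≡ 1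
      layer≡1    : ∀ {u} → layer u ≡ 1 → Adj G r u

  module _ {G H : Graph} (ι : H ↪ G) where
    open _↪_ ι

    layering-↪ : Layering G → Layering H
    layering-↪ L = record
      { layer = layer ∘ to
      ; step  = λ e → step (Adj-to e)
      ; good  = good-induced Fin._≟_ to injective
                  (Product.map₁ Adj-to) (Product.map₁ (trans (preserve _ _))) good }
      where
      open Layering L
      Adj-to : ∀ {i j} → Adj H i j → Adj G (to i) (to j)
      Adj-to = trans (sym (preserve _ _))

    rootedLayering-↪ : ∀ {r} → RootedLayering G (to r) → RootedLayering H r
    rootedLayering-↪ R = record
      { layering   = layering-↪ layering
      ; layer-root = layer-root
      ; layer≡0    = injective ∘ layer≡0
      ; layer-adj  = layer-adj ∘ trans (sym (preserve _ _))
      ; layer≡1    = trans (preserve _ _) ∘ layer≡1 }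
      where open RootedLayering R

  module _ {G : Graph} (good : Good (Adj G)) where

    layering-good : Layering G
    layering-good = record { layer = const 0 ; step = λ _ → z≤n ; good = good-same-level _ good }

    -- Layers follow the distance from `r`, cut off at 2: layer 2 holds every vertex outside the
    -- closed neighbourhood of `r`, reachable or not. Any levels would be good here, by
    -- `good-same-level`.
    rootedLayering-good : ∀ r → RootedLayering G r
    rootedLayering-good r = record
      { layering = record
        { layer = λ u → layerOf (u Fin.≟ r) (adj? G r u)
        ; step  = λ {u} {v} → stepOf (u Fin.≟ r) (adj? G r u) (v Fin.≟ r) (adj? G r v)
        ; good  = good-same-level _ good }
      ; layer-root = rootOf _ _
      ; layer≡0    = ≡0Of _ _
      ; layer-adj  = adjOf _ _
      ; layer≡1    = ≡1Of _ _ }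
      where
      layerOf : ∀ {u} → Dec (u ≡ r) → Dec (Adj G r u) → ℕ
      layerOf (yes _) _       = 0
      layerOf (no _)  (yes _) = 1
      layerOf (no _)  (no _)  = 2

      stepOf : ∀ {u v} (d : Dec (u ≡ r)) (d′ : Dec (Adj G r u)) (e : Dec (v ≡ r)) (e′ : Dec (Adj G r v)) →
               Adj G u v → layerOf d d′ ≤ suc (layerOf e e′)
      stepOf (yes _) _       _          _       _ = z≤n
      stepOf (no _)  (yes _) _          _       _ = s≤s z≤n
      stepOf (no _)  (no ¬a) (yes refl) _       a = contradiction (adj-symmetric G a) ¬a
      stepOf (no _)  (no _)  (no _)     (yes _) _ = ≤-refl
      stepOf (no _)  (no _)  (no _)     (no _)  _ = s≤s (s≤s z≤n)

      rootOf : ∀ (d : Dec (r ≡ r)) d′ → layerOf d d′ ≡ 0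
      rootOf (yes _) _   = refl
      rootOf (no r≢r) _  = contradiction refl r≢r

      ≡0Of : ∀ {u} (d : Dec (u ≡ r)) d′ → layerOf d d′ ≡ 0 → u ≡ r
      ≡0Of (yes u≡r) _       _  = u≡r
      ≡0Of (no _)    (yes _) ()
      ≡0Of (no _)    (no _)  ()

      adjOf : ∀ {u} (d : Dec (u ≡ r)) d′ → Adj G r u → layerOf d d′ ≡ 1
      adjOf (yes refl) _       a = contradiction a (adj-irreflexive G)
      adjOf (no _)     (yes _) _ = refl
      adjOf (no _)     (no ¬a) a = contradiction a ¬a

      ≡1Of : ∀ {u} (d : Dec (u ≡ r)) (d′ : Dec (Adj G r u)) → layerOf d d′ ≡ 1 → Adj G r u
      ≡1Of (no _) (yes a) _ = a

  module _ {G H : Graph} (L : Layering G) (M : Layering H) where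
    private
      module L = Layering L
      module M = Layering M

      -- Layers 0 and 1 are determined by the root, which may lie in G.
      unionLayer : Fin (n G) ⊎ Fin (n H) → ℕ
      unionLayer = [ L.layer , (λ y → 2 + M.layer y) ]′

      union-step : ∀ {p q} → Union (Adj G) (Adj H) p q → unionLayer p ≤ suc (unionLayer q)
      union-step (left e)  = L.step e
      union-step (right e) = s≤s (s≤s (M.step e))

      refine : ∀ {p q} → Union (Adj G) (Adj H) p q → unionLayer p ≡ unionLayer q →
               Union L.SameLayer M.SameLayer p q
      refine (left e)  eq = left (e , eq)
      refine (right e) eq = right (e , +-cancelˡ-≡ 2 _ _ eq)

      forget : ∀ {p q} → Union L.SameLayer M.SameLayer p q →
               Union (Adj G) (Adj H) p q × unionLayer p ≡ unionLayer q
      forget (left (e , eq))  = left e , eq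
      forget (right (e , eq)) = right e , cong (2 +_) eq

    layering-union : Layering (disjointUnion G H)
    layering-union = record
      { layer = unionLayer ∘ splitAt (n G)
      ; step  = λ {i} {j} e → union-step (adj⇒union G H i j e)
      ; good  = good-induced (SumP.≡-dec Fin._≟_ Fin._≟_) (splitAt (n G)) (splitAt-injective (n G))
                  (λ {i} {j} (e , eq) → refine (adj⇒union G H i j e) eq)
                  (λ {i} {j} e → Product.map₁ (union⇒adj G H i j) (forget e))
                  (good-union L.good M.good) }

  rootedLayering-union : ∀ {G H r z} → RootedLayering G r → Layering H →
                         splitAt (n G) z ≡ inj₁ r → RootedLayering (disjointUnion G H) z
  rootedLayering-union {G} {H} {r} {z} R M z≡r = record
    { layering   = layering-union layering M
    ; layer-root = trans (cong [ layer , (λ y → 2 + Layering.layer M y) ]′ z≡r) layer-root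
    ; layer≡0    = λ {u} → ≡0 u
    ; layer-adj  = λ {u} e → adjacent (subst (λ p → Union (Adj G) (Adj H) p (splitAt (n G) u)) z≡r (adj⇒union G H z u e))
    ; layer≡1    = λ {u} eq → union⇒adj G H z u (subst (λ p → Union (Adj G) (Adj H) p (splitAt (n G) u)) (sym z≡r) (≡1 _ eq)) }
    where
    open RootedLayering R
    unionLayer : Fin (n G) ⊎ Fin (n H) → ℕ
    unionLayer = [ layer , (λ y → 2 + Layering.layer M y) ]′

    ≡0 : ∀ u → unionLayer (splitAt (n G) u) ≡ 0 → u ≡ z
    ≡0 u eq with splitAt (n G) u in u≡
    ... | inj₁ x = splitAt-injective (n G) (trans u≡ (trans (cong inj₁ (layer≡0 eq)) (sym z≡r)))

    adjacent : ∀ {q} → Union (Adj G) (Adj H) (inj₁ r) q → unionLayer q ≡ 1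
    adjacent (left e) = layer-adj e

    ≡1 : ∀ q → unionLayer q ≡ 1 → Union (Adj G) (Adj H) (inj₁ r) q
    ≡1 (inj₁ x) eq = left (layer≡1 eq)

  module JoinLayer {G H : Graph} (v : Fin (n G)) {w : Fin (n H)} (L : Layering G) (R : RootedLayering H w) where
    private
      module L = Layering L
      module R = RootedLayering R

    joinLayer : Fin (n G) ⊎ Fin (n H) → ℕ
    joinLayer (inj₁ x) = L.layer x
    -- Layer 1 of `H` lands in the layer of `v`, and each later layer one further on.
    joinLayer (inj₂ y) = L.layer v + pred (R.layer y)

    pred-layer-adj : ∀ {y} → Adj H w y → joinLayer (inj₂ y) ≡ L.layer v
    pred-layer-adj e = trans (cong (λ x → L.layer v + pred x) (R.layer-adj e)) (+-identityʳ _)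

    suc-pred-layer : ∀ {y} → inj₂ y ≢ inj₂ {A = Fin (n G)} w → suc (pred (R.layer y)) ≡ R.layer y
    suc-pred-layer {y} y≢w with R.layer y in eq
    ... | zero  = contradiction (cong inj₂ (R.layer≡0 eq)) y≢w
    ... | suc _ = refl

    private
      J = Joined G v H w
      Same = Substitution L.SameLayer v R.SameLayer (λ y → R.layer y ≡ 1)

      join-step : ∀ {p q} → J p q → joinLayer p ≤ suc (joinLayer q)
      join-step (outer e) = L.step e
      join-step (inner {y} {y′} e) = subst (L.layer v + pred (R.layer y) ≤_) (+-suc _ _)
        (+-monoʳ-≤ (L.layer v) (≤-trans (pred-mono-≤ (R.step e)) (suc-pred≥ (R.layer y′))))
        where
        suc-pred≥ : ∀ x → x ≤ suc (pred x)
        suc-pred≥ zero    = z≤n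
        suc-pred≥ (suc x) = ≤-refl
      join-step (out-in {u} e p) = subst (λ x → L.layer u ≤ suc x) (sym (pred-layer-adj p)) (L.step e)
      join-step (in-out {u} e p) = subst (_≤ suc (L.layer u)) (sym (pred-layer-adj p)) (L.step (adj-symmetric G e))

      -- `pred` merges layers 0 and 1 of `H`; excluding `w`, the only vertex of layer 0, makes it
      -- injective on layers.
      refine : ∀ {p q} → p ≢ inj₂ w → q ≢ inj₂ w → J p q → joinLayer p ≡ joinLayer q → Same p q
      refine _ _ (outer e) eq = outer (e , eq)
      refine p≢ q≢ (inner e) eq = inner (e , trans (sym (suc-pred-layer p≢))
        (trans (cong suc (+-cancelˡ-≡ (L.layer v) _ _ eq)) (suc-pred-layer q≢)))
      refine _ _ (out-in e p) eq = out-in (e , trans eq (pred-layer-adj p)) (R.layer-adj p)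
      refine _ _ (in-out e p) eq = in-out (e , trans (sym eq) (pred-layer-adj p)) (R.layer-adj p)

      forget : ∀ {p q} → Same p q → J p q × joinLayer p ≡ joinLayer q
      forget (outer (e , eq)) = outer e , eq
      forget (inner (e , eq)) = inner e , cong (λ x → L.layer v + pred x) eq
      forget (out-in (e , eq) p) = out-in e (R.layer≡1 p) , trans eq (sym (pred-layer-adj (R.layer≡1 p)))
      forget (in-out (e , eq) p) = in-out e (R.layer≡1 p) , trans (pred-layer-adj (R.layer≡1 p)) (sym eq)

    -- The neighbourhood of `w` need not be closed under adjacency in `H`, but being layer 1 it is
    -- closed under edges within layers. This is the condition `P-closed`, so the substitution is
    -- made in the same-layer graphs.
    layering-join : Layering (oneJoin G v H w)
    layering-join = record
      { layer = joinLayer ∘ sides G v H w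
      ; step  = λ {i} {j} e → join-step (adj⇒joined G v H w i j e)
      ; good  = good-induced (SumP.≡-dec Fin._≟_ Fin._≟_) (sides G v H w) (sides-injective G v H w)
                  (λ {i} {j} (e , eq) → refine (sides≢ G v H w i) (sides≢ G v H w j) (adj⇒joined G v H w i j e) eq)
                  (λ {i} {j} e → Product.map₁ (joined⇒adj G v H w i j) (forget e))
                  (good-substitution (partialSum-mono (power k)) L.SameLayer v R.SameLayer (λ y → R.layer y ≟ 1)
                    L.sameLayer? L.sameLayer-symmetric L.sameLayer-irreflexive
                    R.sameLayer? R.sameLayer-symmetric R.sameLayer-irreflexive
                    (λ (_ , eq) p → trans (sym eq) p) L.good R.good) }

  -- As `r ≢ v`, the layer of `v` is at least 1, so no vertex of `H` reaches layer 0. A vertex of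
  -- `H` is in layer 1 exactly when `v` is adjacent to `r` and the vertex to `w`, which is how the
  -- 1-join makes it adjacent to `r`.
  rootedLayering-join : ∀ {G H r z} (v : Fin (n G)) {w : Fin (n H)} →
    RootedLayering G r → RootedLayering H w → r ≢ v → sides G v H w z ≡ inj₁ r →
    RootedLayering (oneJoin G v H w) z
  rootedLayering-join {G} {H} {r} {z} v {w} Q R r≢v z≡r = record
    { layering   = layering-join
    ; layer-root = trans (cong joinLayer z≡r) Q.layer-root
    ; layer≡0    = λ {u} eq → sides-injective G v H w (trans (≡0 _ eq) (sym z≡r))
    ; layer-adj  = λ {u} e → adjacent (subst (λ p → Joined G v H w p (sides G v H w u)) z≡r (adj⇒joined G v H w z u e))
    ; layer≡1    = λ {u} eq → joined⇒adj G v H w z u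
        (subst (λ p → Joined G v H w p (sides G v H w u)) (sym z≡r) (≡1 _ (sides≢ G v H w u) eq)) }
    where
    module Q = RootedLayering Q
    module R = RootedLayering R
    open JoinLayer v Q.layering R

    layer-v≢0 : Q.layer v ≢ 0
    layer-v≢0 eq = r≢v (sym (Q.layer≡0 eq))

    ≡0 : ∀ q → joinLayer q ≡ 0 → q ≡ inj₁ r
    ≡0 (inj₁ x) eq = cong inj₁ (Q.layer≡0 eq)
    ≡0 (inj₂ y) eq = contradiction (m+n≡0⇒m≡0 (Q.layer v) eq) layer-v≢0

    adjacent : ∀ {q} → Joined G v H w (inj₁ r) q → joinLayer q ≡ 1
    adjacent (outer e)    = Q.layer-adj e
    adjacent (out-in e p) = trans (pred-layer-adj p) (Q.layer-adj e)

    split : ∀ {a b} → a ≢ 0 → a + b ≡ 1 → a ≡ 1 × b ≡ 0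
    split {zero}        a≢0 _  = contradiction refl a≢0
    split {suc zero}    _   eq = refl , suc-injective eq

    ≡1 : ∀ q → q ≢ inj₂ w → joinLayer q ≡ 1 → Joined G v H w (inj₁ r) q
    ≡1 (inj₁ x) _   eq = outer (Q.layer≡1 eq)
    ≡1 (inj₂ y) q≢w eq with split layer-v≢0 eq
    ... | v≡1 , y≡0 = out-in (Q.layer≡1 v≡1) (R.layer≡1 (trans (sym (suc-pred-layer q≢w)) (cong suc y≡0)))

  -- The unrooted layering is carried separately, since a graph without vertices offers no root.
  AllLayerings : Graph → Set
  AllLayerings G = Layering G × (∀ r → RootedLayering G r)

  allLayerings-union : ∀ {G H} → AllLayerings G → AllLayerings H → AllLayerings (disjointUnion G H)
  allLayerings-union {G} {H} (L , Ls) (M , Ms) = layering-union L M , rooted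
    where
    rooted : ∀ z → RootedLayering (disjointUnion G H) z
    rooted z with splitAt (n G) z in eq
    ... | inj₁ x = rootedLayering-union (Ls x) M eq
    ... | inj₂ y = rootedLayering-↪ (disjointUnion-swap G H)
                     (rootedLayering-union (Ms y) L (trans (splitAt-swapSides (n G) (n H) z) (cong swap eq)))

  allLayerings-join : ∀ {G H} → AllLayerings G → AllLayerings H → ∀ v w → AllLayerings (oneJoin G v H w)
  allLayerings-join {G} {H} (L , Ls) (M , Ms) v w = JoinLayer.layering-join v L (Ms w) , rooted
    where
    rooted : ∀ z → RootedLayering (oneJoin G v H w) z
    rooted z with splitAt (pred (n G)) z in eq
    ... | inj₁ x = rootedLayering-join v (Ls (skip v x)) (Ms w) (skip≢ v)
                     (cong (Sum.map (skip v) (skip w)) eq)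
    ... | inj₂ y = rootedLayering-↪ (oneJoin-swap G v H w)
                     (rootedLayering-join w (Ms (skip w y)) (Ls v) (skip≢ w)
                       (cong (Sum.map (skip w) (skip v))
                         (trans (splitAt-swapSides (pred (n G)) (pred (n H)) z) (cong swap eq))))

  allLayerings-iso : ∀ {G H} → G ≅ H → AllLayerings G → AllLayerings H
  allLayerings-iso {G} {H} G≅H (L , Ls) = layering-↪ ι L , λ r → rootedLayering-↪ ι (Ls (from r))
    where
    open _≅_ G≅H
    open Inverse bij using (from; strictlyInverseˡ)
    ι : H ↪ G
    ι = record
      { to        = from
      ; injective = λ {i} {j} eq → trans (sym (strictlyInverseˡ i)) (trans (cong (Inverse.to bij) eq) (strictlyInverseˡ j))
      ; preserve  = λ i j → sym (trans (preserve (from i) (from j)) (cong₂ (adj H) (strictlyInverseˡ i) (strictlyInverseˡ j))) }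

  closure-layerings : ∀ {𝒢 : GraphClass} → (∀ {G} → 𝒢 G → Good (Adj G)) →
                      ∀ {G} → Closure 𝒢 G → AllLayerings G
  closure-layerings good (base G∈)        = layering-good (good G∈) , rootedLayering-good (good G∈)
  closure-layerings good (iso G≅H c)      = allLayerings-iso G≅H (closure-layerings good c)
  closure-layerings good (union c d)      = allLayerings-union (closure-layerings good c) (closure-layerings good d)
  closure-layerings good (join c d _ _ v w) =
    allLayerings-join (closure-layerings good c) (closure-layerings good d) v w

  -- With weight 1 everywhere, each vertex has `powerSum k 1 = 1` colour, of index 0, among
  -- `powerSum k w`. Pairing it with the parity of the layer separates consecutive layers and
  -- doubles the count.
  layering⇒colorable : ∀ {G w} → Layering G → IsCliqueNumber G w → Colorable G (2 * powerSum k w)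
  layering⇒colorable {G} {w} L (_ , maximal) =
    (λ v → combine (parity (layer v)) (fromℕ< (bounded {v} 0<))) , proper
    where
    open Layering L
    open Assignment (good (const 1) w (λ C clique → subst (_≤ w) (sym (weight-const1 C))
      (maximal (length C) (lookup C , AllPairs-lookup-injective sameLayer-symmetric sameLayer-irreflexive clique
                          , λ _ _ → proj₁ ∘ AllPairs-lookup sameLayer-symmetric clique))))

    0< : 0 < powerSum k 1
    0< = m^n>0 1 (k + k)

    proper : ∀ i j → Adj G i j → combine (parity (layer i)) (fromℕ< (bounded {i} 0<)) ≢
                                 combine (parity (layer j)) (fromℕ< (bounded {j} 0<))
    proper i j e eq with combine-injective _ _ _ _ eq
    ... | eq₁ , eq₂ = separated {i} {j} (e , same-parity (step e) (step (adj-symmetric G e)) eq₁) 0< 0<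
                        (fromℕ<-injective _ _ _ _ eq₂)

-- Polynomial bounds

eval≤power : ∀ f → ∃ λ k → ∀ x → 2 ≤ x → eval f x ≤ x ^ k
eval≤power []      = 0 , λ _ _ → z≤n
eval≤power (a ∷ f) with eval≤power f
-- Both summands are at most `x ^ suc (a + k)`, using `a ≤ x ^ a`; one more factor `x ≥ 2` absorbs
-- the doubling.
... | k , eval≤ = 2 + (a + k) , bound
  where
  n≤x^n : ∀ x m → 2 ≤ x → m ≤ x ^ m
  n≤x^n x zero    2≤x = z≤n
  n≤x^n x (suc m) 2≤x = ≤-trans (+-mono-≤ (m^n>0 x {{>-nonZero (≤-trans (s≤s z≤n) 2≤x)}} m) (n≤x^n x m 2≤x))
    (≤-trans (≤-reflexive (cong (x ^ m +_) (sym (+-identityʳ _)))) (*-monoˡ-≤ (x ^ m) 2≤x))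

  bound : ∀ x → 2 ≤ x → a + x * eval f x ≤ x ^ (2 + (a + k))
  bound x 2≤x = begin
    a + x * eval f x          ≤⟨ +-mono-≤ (n≤x^n x a 2≤x) (*-monoʳ-≤ x (eval≤ x 2≤x)) ⟩
    x ^ a + x ^ suc k         ≤⟨ +-mono-≤ (^-monoʳ-≤ x (≤-trans (m≤m+n a k) (n≤1+n _))) (^-monoʳ-≤ x (s≤s (m≤n+m k a))) ⟩
    y + y                     ≡⟨ cong (y +_) (+-identityʳ y) ⟨
    2 * y                     ≤⟨ *-monoˡ-≤ y 2≤x ⟩
    x * y                     ∎
    where
    open ≤-Reasoning
    instance _ = >-nonZero (≤-trans (s≤s z≤n) 2≤x)
    y : ℕ
    y = x ^ suc (a + k)

powerSum≤ : ∀ k x → powerSum k x ≤ x * x ^ (k + k)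
powerSum≤ k x = go x ≤-refl
  where
  go : ∀ i → i ≤ x → powerSum k i ≤ i * x ^ (k + k)
  go zero    _  = z≤n
  go (suc i) i< = ≤-trans (≤-reflexive (+-comm (powerSum k i) _))
                    (+-mono-≤ (^-monoˡ-≤ (k + k) i<) (go i (<⇒≤ i<)))

monomial : ℕ → ℕ → Poly
monomial c zero    = c ∷ []
monomial c (suc d) = 0 ∷ monomial c d

eval-monomial : ∀ c d x → eval (monomial c d) x ≡ c * x ^ d
eval-monomial c zero    x = trans (cong (c +_) (*-zeroʳ x)) (trans (+-identityʳ c) (sym (*-identityʳ c)))
eval-monomial c (suc d) x = begin
  x * eval (monomial c d) x ≡⟨ cong (x *_) (eval-monomial c d x) ⟩
  x * (c * x ^ d)           ≡⟨ *-assoc x c _ ⟨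
  x * c * x ^ d             ≡⟨ cong (_* x ^ d) (*-comm x c) ⟩
  c * x * x ^ d             ≡⟨ *-assoc c x _ ⟩
  c * x ^ suc d             ∎
  where open ≡-Reasoning

colorable-mono : ∀ {G i j} → i ≤ j → Colorable G i → Colorable G j
colorable-mono i≤j (c , proper) = (λ v → Fin.inject≤ (c v) i≤j)
  , λ u v e eq → proper u v e (inject≤-injective i≤j i≤j _ _ eq)

theorem1p2 : (𝒢 : GraphClass) → PolyChiBounded 𝒢 → PolyChiBounded (Closure 𝒢)
theorem1p2 𝒢 (f , χ-bounded) with eval≤power f
... | k , eval≤ = monomial 2 (suc (k + k)) , λ G G∈ ι ι-injective w number →
  colorable-mono {induced G ι}
    (≤-trans (*-monoʳ-≤ 2 (powerSum≤ k w)) (≤-reflexive (sym (eval-monomial 2 (suc (k + k)) w))))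
    (layering⇒colorable k {induced G ι}
      -- The layering of the whole graph is restricted first, so that the colours are counted by the
      -- clique number of the induced subgraph.
      (layering-↪ k (record { to = ι ; injective = ι-injective ; preserve = λ _ _ → refl })
        (proj₁ (closure-layerings k good G∈)))
      number)
  where
  good : ∀ {G} → 𝒢 G → Assignments.Good (powerSum k) (Adj G)
  good {G} G∈ = hereditarilyColourable⇒good k G (eval f) eval≤ (χ-bounded G G∈)
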